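{- For all sets of formulas $\Gamma \subseteq Fm$ and all formulas $\varphi \in Fm$: $\Gamma \models_{\mathcal{LB}} \varphi$ if and only if $\Gamma \vdash_{H} \varphi$.
   Context: $\mathbf{Fm}$ is the algebra of formulas (with universe $Fm$) over a countable set of variables in the language $\{\land,\lor,\otimes,\oplus,\neg\}$ ($\land,\lor,\otimes,\oplus$ binary, $\neg$ unary, no constants). $\mathcal{FOUR}$ is the algebra with universe $\{\mathsf f,\bot,\top,\mathsf t\}$ where $\land,\lor$ are meet and join of the lattice order $\leq_t$ with $\mathsf f <_t \bot,\top <_t \mathsf t$ ($\bot,\top$ $\leq_t$-incomparable), $\otimes,\oplus$ are meet and join of the lattice order $\leq_k$ with $\bot <_k \mathsf f,\mathsf t <_k \top$ ($\mathsf f,\mathsf t$ $\leq_k$-incomparable), and $\neg \mathsf f = \mathsf t$, $\neg\mathsf t=\mathsf f$, $\neg\bot=\bot$, $\neg\top=\top$. Let $\mathsf{Tr}=\{\top,\mathsf t\}$. Define $\Gamma\models_{\mathcal{LB}}\varphi$ iff for every homomorphism $h:\mathbf{Fm}\to\mathcal{FOUR}$, $h[\Gamma]\subseteq \mathsf{Tr}$ implies $h(\varphi)\in\mathsf{Tr}$. $\vdash_H$ is the (finitary, substitution-invariant) consequence relation given by the Hilbert calculus with no axioms and the following rules (premises $/$ conclusion): (R1) $p\land q / p$; (R2) $p\land q/q$; (R3) $p, q/ p\land q$; (R4) $p/p\lor q$; (R5) $p\lor q/q\lor p$; (R6) $p\lor p/p$; (R7) $p\lor(q\lor r)/(p\lor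 q)\lor r$; (R8) $p\lor(q\land r)/(p\lor q)\land(p\lor r)$; (R9) $(p\lor q)\land(p\lor r)/p\lor(q\land r)$; (R10) $p\lor r/\neg\neg p\lor r$; (R11) $\neg\neg p\lor r/p\lor r$; (R12) $\neg(p\lor q)\lor r/(\neg p\land\neg q)\lor r$; (R13) $(\neg p\land\neg q)\lor r/\neg(p\lor q)\lor r$; (R14) $\neg(p\land q)\lor r/(\neg p\lor\neg q)\lor r$; (R15) $(\neg p\lor\neg q)\lor r/\neg(p\land q)\lor r$; (R16) $(p\otimes q)\lor r/(p\land q)\lor r$; (R17) $(p\land q)\lor r/(p\otimes q)\lor r$; (R18) $(p\oplus q)\lor r/(p\lor q)\lor r$; (R19) $(p\lor q)\lor r/(p\oplus q)\lor r$; (R20) $(\neg p\otimes\neg q)\lor r/\neg(p\otimes q)\lor r$; (R21) $\neg(p\otimes q)\lor r/(\neg p\otimes\neg q)\lor r$; (R22) $(\neg p\oplus\neg q)\lor r/\neg(p\oplus q)\lor r$; (R23) $\neg(p\oplus q)\lor r/(\neg p\oplus\neg q)\lor r$. -}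

module Defs where

open import Data.List using (List; []; _∷_; [_])
open import Data.List.Relation.Unary.All using (All)
open import Data.Nat using (ℕ)
open import Data.Product using (_,_)
open import Level using (Level)
open import Relation.Binary.Definitions using (Transitive; Antisymmetric)
open import Relation.Binary.Lattice using (IsLattice; Supremum; Infimum)
open import Relation.Binary.PropositionalEquality
  using (_≡_; _≢_; refl; sym; subst; isEquivalence)
open import Relation.Binary.Structures using (IsPartialOrder)
open import Relation.Nullary using (contradiction)
open import Relation.Unary using (Pred; _∈_; _∪_; ｛_｝)

record Algebra : Set₁ where
  field
    Carrier         : Set
    and or otimes oplus : Carrier → Carrier → Carrier
    neg             : Carrier → Carrier

record IsHomomorphism (A B : Algebra)
                      (h : Algebra.Carrier A → Algebra.Carrier B) : Set where
  private
    module A = Algebra A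
    module B = Algebra B
  field
    and-homo    : ∀ x y → h (A.and x y) ≡ B.and (h x) (h y)
    or-homo     : ∀ x y → h (A.or x y) ≡ B.or (h x) (h y)
    otimes-homo : ∀ x y → h (A.otimes x y) ≡ B.otimes (h x) (h y)
    oplus-homo  : ∀ x y → h (A.oplus x y) ≡ B.oplus (h x) (h y)
    neg-homo    : ∀ x → h (A.neg x) ≡ B.neg (h x)

infix  8 ∼_
infixr 7 _∧_ _⊗_
infixr 6 _∨_ _⊕_

-- The object-language negation is written ∼ to avoid the metalanguage ¬.
data Fm : Set where
  var             : ℕ → Fm
  _∧_ _∨_ _⊗_ _⊕_ : Fm → Fm → Fm
  ∼_              : Fm → Fm

𝐅𝐦 : Algebra
𝐅𝐦 = record
  { Carrier = Fm ; and = _∧_ ; or = _∨_ ; otimes = _⊗_ ; oplus = _⊕_ ; neg = ∼_ }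

infix 9 _⟨_⟩

_⟨_⟩ : Fm → (ℕ → Fm) → Fm
var n   ⟨ σ ⟩ = σ n
(φ ∧ ψ) ⟨ σ ⟩ = (φ ⟨ σ ⟩) ∧ (ψ ⟨ σ ⟩)
(φ ∨ ψ) ⟨ σ ⟩ = (φ ⟨ σ ⟩) ∨ (ψ ⟨ σ ⟩)
(φ ⊗ ψ) ⟨ σ ⟩ = (φ ⟨ σ ⟩) ⊗ (ψ ⟨ σ ⟩)
(φ ⊕ ψ) ⟨ σ ⟩ = (φ ⟨ σ ⟩) ⊕ (ψ ⟨ σ ⟩)
(∼ φ)   ⟨ σ ⟩ = ∼ (φ ⟨ σ ⟩)

data Four : Set where
  f₄ ⊥₄ ⊤₄ t₄ : Four

-- The order on Four with least element lo and greatest element hi, the two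
-- remaining elements being incomparable (intended for lo ≢ hi).
data Diamond (lo hi : Four) : Four → Four → Set where
  ≤-refl : ∀ {x} → Diamond lo hi x x
  lo≤    : ∀ {x} → Diamond lo hi lo x
  ≤hi    : ∀ {x} → Diamond lo hi x hi

infix 4 _≤t_ _≤k_

_≤t_ _≤k_ : Four → Four → Set
_≤t_ = Diamond f₄ t₄
_≤k_ = Diamond ⊥₄ ⊤₄

infixr 7 _∧₄_ _⊗₄_
infixr 6 _∨₄_ _⊕₄_

_∧₄_ _∨₄_ _⊗₄_ _⊕₄_ : Four → Four → Four

f₄ ∧₄ y  = f₄
t₄ ∧₄ y  = y
⊥₄ ∧₄ f₄ = f₄
⊥₄ ∧₄ ⊥₄ = ⊥₄
⊥₄ ∧₄ ⊤₄ = f₄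
⊥₄ ∧₄ t₄ = ⊥₄
⊤₄ ∧₄ f₄ = f₄
⊤₄ ∧₄ ⊥₄ = f₄
⊤₄ ∧₄ ⊤₄ = ⊤₄
⊤₄ ∧₄ t₄ = ⊤₄

f₄ ∨₄ y  = y
t₄ ∨₄ y  = t₄
⊥₄ ∨₄ f₄ = ⊥₄
⊥₄ ∨₄ ⊥₄ = ⊥₄
⊥₄ ∨₄ ⊤₄ = t₄
⊥₄ ∨₄ t₄ = t₄
⊤₄ ∨₄ f₄ = ⊤₄
⊤₄ ∨₄ ⊥₄ = t₄
⊤₄ ∨₄ ⊤₄ = ⊤₄
⊤₄ ∨₄ t₄ = t₄

⊥₄ ⊗₄ y  = ⊥₄
⊤₄ ⊗₄ y  = y
f₄ ⊗₄ f₄ = f₄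
f₄ ⊗₄ ⊥₄ = ⊥₄
f₄ ⊗₄ ⊤₄ = f₄
f₄ ⊗₄ t₄ = ⊥₄
t₄ ⊗₄ f₄ = ⊥₄
t₄ ⊗₄ ⊥₄ = ⊥₄
t₄ ⊗₄ ⊤₄ = t₄
t₄ ⊗₄ t₄ = t₄

⊥₄ ⊕₄ y  = y
⊤₄ ⊕₄ y  = ⊤₄
f₄ ⊕₄ f₄ = f₄
f₄ ⊕₄ ⊥₄ = f₄
f₄ ⊕₄ ⊤₄ = ⊤₄
f₄ ⊕₄ t₄ = ⊤₄
t₄ ⊕₄ f₄ = ⊤₄
t₄ ⊕₄ ⊥₄ = t₄
t₄ ⊕₄ ⊤₄ = ⊤₄
t₄ ⊕₄ t₄ = t₄

∼₄_ : Four → Four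
∼₄ f₄ = t₄
∼₄ ⊥₄ = ⊥₄
∼₄ ⊤₄ = ⊤₄
∼₄ t₄ = f₄

Diamond-isPartialOrder : ∀ {lo hi} → lo ≢ hi → IsPartialOrder _≡_ (Diamond lo hi)
Diamond-isPartialOrder {lo} {hi} lo≢hi = record
  { isPreorder = record
    { isEquivalence = isEquivalence
    ; reflexive     = λ { refl → ≤-refl }
    ; trans         = ≤-trans
    }
  ; antisym = ≤-antisym
  }
  where
  above-hi : ∀ {x y} → Diamond lo hi x y → x ≡ hi → y ≡ hi
  above-hi ≤-refl x≡hi  = x≡hi
  above-hi lo≤    lo≡hi = contradiction lo≡hi lo≢hi
  above-hi ≤hi    _     = refl

  below-lo : ∀ {x y} → Diamond lo hi x y → y ≡ lo → x ≡ lo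
  below-lo ≤-refl y≡lo  = y≡lo
  below-lo lo≤    _     = refl
  below-lo ≤hi    hi≡lo = contradiction (sym hi≡lo) lo≢hi

  ≤-trans : Transitive (Diamond lo hi)
  ≤-trans ≤-refl q = q
  ≤-trans lo≤    _ = lo≤
  ≤-trans ≤hi    q = subst (Diamond lo hi _) (sym (above-hi q refl)) ≤hi

  ≤-antisym : Antisymmetric _≡_ (Diamond lo hi)
  ≤-antisym ≤-refl _ = refl
  ≤-antisym lo≤    q = sym (below-lo q refl)
  ≤-antisym ≤hi    q = above-hi q refl

≤t-isLattice : IsLattice _≡_ _≤t_ _∨₄_ _∧₄_
≤t-isLattice = record
  { isPartialOrder = Diamond-isPartialOrder λ ()
  ; supremum       = sup
  ; infimum        = inf
  }
  where
  sup : Supremum _≤t_ _∨₄_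
  sup f₄ y  = lo≤ , ≤-refl , λ _ _ q → q
  sup t₄ y  = ≤-refl , ≤hi , λ _ p _ → p
  sup ⊥₄ f₄ = ≤-refl , lo≤ , λ _ p _ → p
  sup ⊥₄ ⊥₄ = ≤-refl , ≤-refl , λ _ p _ → p
  sup ⊥₄ ⊤₄ = ≤hi , ≤hi , λ { _ ≤-refl () ; _ ≤hi _ → ≤-refl }
  sup ⊥₄ t₄ = ≤hi , ≤-refl , λ _ _ q → q
  sup ⊤₄ f₄ = ≤-refl , lo≤ , λ _ p _ → p
  sup ⊤₄ ⊥₄ = ≤hi , ≤hi , λ { _ ≤-refl () ; _ ≤hi _ → ≤-refl }
  sup ⊤₄ ⊤₄ = ≤-refl , ≤-refl , λ _ p _ → p
  sup ⊤₄ t₄ = ≤hi , ≤-refl , λ _ _ q → q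

  inf : Infimum _≤t_ _∧₄_
  inf f₄ y  = ≤-refl , lo≤ , λ _ p _ → p
  inf t₄ y  = ≤hi , ≤-refl , λ _ _ q → q
  inf ⊥₄ f₄ = lo≤ , ≤-refl , λ _ _ q → q
  inf ⊥₄ ⊥₄ = ≤-refl , ≤-refl , λ _ p _ → p
  inf ⊥₄ ⊤₄ = lo≤ , lo≤ , λ { _ ≤-refl () ; _ lo≤ _ → ≤-refl }
  inf ⊥₄ t₄ = ≤-refl , ≤hi , λ _ p _ → p
  inf ⊤₄ f₄ = lo≤ , ≤-refl , λ _ _ q → q
  inf ⊤₄ ⊥₄ = lo≤ , lo≤ , λ { _ ≤-refl () ; _ lo≤ _ → ≤-refl }
  inf ⊤₄ ⊤₄ = ≤-refl , ≤-refl , λ _ p _ → p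
  inf ⊤₄ t₄ = ≤-refl , ≤hi , λ _ p _ → p

≤k-isLattice : IsLattice _≡_ _≤k_ _⊕₄_ _⊗₄_
≤k-isLattice = record
  { isPartialOrder = Diamond-isPartialOrder λ ()
  ; supremum       = sup
  ; infimum        = inf
  }
  where
  sup : Supremum _≤k_ _⊕₄_
  sup ⊥₄ y  = lo≤ , ≤-refl , λ _ _ q → q
  sup ⊤₄ y  = ≤-refl , ≤hi , λ _ p _ → p
  sup f₄ f₄ = ≤-refl , ≤-refl , λ _ p _ → p
  sup f₄ ⊥₄ = ≤-refl , lo≤ , λ _ p _ → p
  sup f₄ ⊤₄ = ≤hi , ≤-refl , λ _ _ q → q
  sup f₄ t₄ = ≤hi , ≤hi , λ { _ ≤-refl () ; _ ≤hi _ → ≤-refl }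
  sup t₄ f₄ = ≤hi , ≤hi , λ { _ ≤-refl () ; _ ≤hi _ → ≤-refl }
  sup t₄ ⊥₄ = ≤-refl , lo≤ , λ _ p _ → p
  sup t₄ ⊤₄ = ≤hi , ≤-refl , λ _ _ q → q
  sup t₄ t₄ = ≤-refl , ≤-refl , λ _ p _ → p

  inf : Infimum _≤k_ _⊗₄_
  inf ⊥₄ y  = ≤-refl , lo≤ , λ _ p _ → p
  inf ⊤₄ y  = ≤hi , ≤-refl , λ _ _ q → q
  inf f₄ f₄ = ≤-refl , ≤-refl , λ _ p _ → p
  inf f₄ ⊥₄ = lo≤ , ≤-refl , λ _ _ q → q
  inf f₄ ⊤₄ = ≤-refl , ≤hi , λ _ p _ → p
  inf f₄ t₄ = lo≤ , lo≤ , λ { _ ≤-refl () ; _ lo≤ _ → ≤-refl }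
  inf t₄ f₄ = lo≤ , lo≤ , λ { _ ≤-refl () ; _ lo≤ _ → ≤-refl }
  inf t₄ ⊥₄ = lo≤ , ≤-refl , λ _ _ q → q
  inf t₄ ⊤₄ = ≤-refl , ≤hi , λ _ p _ → p
  inf t₄ t₄ = ≤-refl , ≤-refl , λ _ p _ → p

𝓕𝓞𝓤𝓡 : Algebra
𝓕𝓞𝓤𝓡 = record
  { Carrier = Four ; and = _∧₄_ ; or = _∨₄_ ; otimes = _⊗₄_ ; oplus = _⊕₄_ ; neg = ∼₄_ }

Tr : Pred Four _
Tr = ｛ ⊤₄ ｝ ∪ ｛ t₄ ｝

infix 3 _⊨LB_ _⊢H_

_⊨LB_ : ∀ {ℓ} → Pred Fm ℓ → Fm → Set ℓ
Γ ⊨LB φ = (h : Fm → Four) → IsHomomorphism 𝐅𝐦 𝓕𝓞𝓤𝓡 h →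
          (∀ {γ} → γ ∈ Γ → h γ ∈ Tr) → h φ ∈ Tr

private
  p q r : Fm
  p = var 0
  q = var 1
  r = var 2

data Rule : List Fm → Fm → Set where
  R1  : Rule [ p ∧ q ] p
  R2  : Rule [ p ∧ q ] q
  R3  : Rule (p ∷ q ∷ []) (p ∧ q)
  R4  : Rule [ p ] (p ∨ q)
  R5  : Rule [ p ∨ q ] (q ∨ p)
  R6  : Rule [ p ∨ p ] p
  R7  : Rule [ p ∨ (q ∨ r) ] ((p ∨ q) ∨ r)
  R8  : Rule [ p ∨ (q ∧ r) ] ((p ∨ q) ∧ (p ∨ r))
  R9  : Rule [ (p ∨ q) ∧ (p ∨ r) ] (p ∨ (q ∧ r))
  R10 : Rule [ p ∨ r ] ((∼ ∼ p) ∨ r)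
  R11 : Rule [ (∼ ∼ p) ∨ r ] (p ∨ r)
  R12 : Rule [ ∼ (p ∨ q) ∨ r ] ((∼ p ∧ ∼ q) ∨ r)
  R13 : Rule [ (∼ p ∧ ∼ q) ∨ r ] (∼ (p ∨ q) ∨ r)
  R14 : Rule [ ∼ (p ∧ q) ∨ r ] ((∼ p ∨ ∼ q) ∨ r)
  R15 : Rule [ (∼ p ∨ ∼ q) ∨ r ] (∼ (p ∧ q) ∨ r)
  R16 : Rule [ (p ⊗ q) ∨ r ] ((p ∧ q) ∨ r)
  R17 : Rule [ (p ∧ q) ∨ r ] ((p ⊗ q) ∨ r)
  R18 : Rule [ (p ⊕ q) ∨ r ] ((p ∨ q) ∨ r)
  R19 : Rule [ (p ∨ q) ∨ r ] ((p ⊕ q) ∨ r)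
  R20 : Rule [ (∼ p ⊗ ∼ q) ∨ r ] (∼ (p ⊗ q) ∨ r)
  R21 : Rule [ ∼ (p ⊗ q) ∨ r ] ((∼ p ⊗ ∼ q) ∨ r)
  R22 : Rule [ (∼ p ⊕ ∼ q) ∨ r ] (∼ (p ⊕ q) ∨ r)
  R23 : Rule [ ∼ (p ⊕ q) ∨ r ] ((∼ p ⊕ ∼ q) ∨ r)

data _⊢H_ {ℓ : Level} (Γ : Pred Fm ℓ) : Fm → Set ℓ where
  hyp  : ∀ {φ} → φ ∈ Γ → Γ ⊢H φ
  rule : ∀ {Π φ} → Rule Π φ → (σ : ℕ → Fm) →
         All (λ π → Γ ⊢H π ⟨ σ ⟩) Π → Γ ⊢H φ ⟨ σ ⟩

{-# OPTIONS --safe #-}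

-- Soundness holds because Tr is a prime filter of both lattices of 𝓕𝓞𝓤𝓡. For
-- completeness let Γ ⊬ φ.  Every rule remains derivable when a disjunct s is
-- added to its premises and conclusion: for R10–R23 by associativity, for
-- R1–R9 with weakening and contraction (R4, R6); this yields proof by cases.
-- Going through the variables and negated variables one at a time, add to Γ
-- each of them that keeps φ underivable, and let Δ be the resulting theory.
-- The valuation read off from the literals derivable from Δ makes true every ψ
-- with Δ , ψ ⊬ φ, in particular all of Γ, whereas every true formula is
-- derivable from Δ, so that φ is not true.  Extending by literals only means
-- that no enumeration of all formulas is needed.
module Submission where

open import Defs
open import Axiom.ExcludedMiddle using (ExcludedMiddle)
open import Data.List using ([]; _∷_)
open import Data.List.Relation.Unary.All using (All; []; _∷_)
open import Data.Nat using (ℕ; zero; suc; _≤_; _⊔_; _≤′_; ≤′-reflexive; ≤′-step)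
open import Data.Nat.Properties using (m≤m⊔n; m≤n⊔m; ≤⇒≤′)
open import Data.Product using (_×_; _,_; proj₁; proj₂; ∃; uncurry)
open import Data.Sum using (_⊎_; inj₁; inj₂; [_,_]′; reduce)
  renaming (map to ⊎-map; map₁ to ⊎-map₁; swap to ⊎-swap)
open import Function.Base using (_∘_)
open import Function.Bundles using (_⇔_; mk⇔; Equivalence)
open import Level using (Level)
open import Relation.Binary.Lattice using (IsLattice)
open import Relation.Binary.PropositionalEquality using (_≡_; refl; sym; trans; cong; subst)
open import Relation.Nullary using (¬_; Dec; yes; no; contradiction)
open import Relation.Unary using (Pred; _∈_; _⊆_; _∪_; ｛_｝)

open Equivalence using (to; from)

private
  variable
    ℓ ℓ′ : Level
    Γ Δ : Pred Fm ℓ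
    a b c d s φ ψ χ : Fm

-- Smullyan's uniform notation: c is conjunctive (disjunctive) with components
-- a and b.
data Conjunctive : Fm → Fm → Fm → Set where
  ∧-conj  : Conjunctive (a ∧ b) a b
  ⊗-conj  : Conjunctive (a ⊗ b) a b
  ∼∨-conj : Conjunctive (∼ (a ∨ b)) (∼ a) (∼ b)
  ∼⊗-conj : Conjunctive (∼ (a ⊗ b)) (∼ a) (∼ b)

data Disjunctive : Fm → Fm → Fm → Set where
  ∨-disj  : Disjunctive (a ∨ b) a b
  ⊕-disj  : Disjunctive (a ⊕ b) a b
  ∼∧-disj : Disjunctive (∼ (a ∧ b)) (∼ a) (∼ b)
  ∼⊕-disj : Disjunctive (∼ (a ⊕ b)) (∼ a) (∼ b)

module _ (P : Pred Fm ℓ)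
  (var-case  : ∀ n → P (var n))
  (∼var-case : ∀ n → P (∼ var n))
  (conj-case : ∀ {a b c} → Conjunctive c a b → P a → P b → P c)
  (disj-case : ∀ {a b c} → Disjunctive c a b → P a → P b → P c)
  (∼∼-case   : ∀ {a} → P a → P (∼ ∼ a)) where

  private
    -- The recursion carries `∼ ψ` along because the components of a formula such as `∼ (a ∧ b)` are
    -- negations of subformulas, not subformulas.
    signed : ∀ ψ → P ψ × P (∼ ψ)
    signed (var n) = var-case n , ∼var-case n
    signed (a ∧ b) with signed a | signed b
    ... | a⁺ , a⁻ | b⁺ , b⁻ = conj-case ∧-conj a⁺ b⁺ , disj-case ∼∧-disj a⁻ b⁻
    signed (a ∨ b) with signed a | signed b
    ... | a⁺ , a⁻ | b⁺ , b⁻ = disj-case ∨-disj a⁺ b⁺ , conj-case ∼∨-conj a⁻ b⁻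
    signed (a ⊗ b) with signed a | signed b
    ... | a⁺ , a⁻ | b⁺ , b⁻ = conj-case ⊗-conj a⁺ b⁺ , conj-case ∼⊗-conj a⁻ b⁻
    signed (a ⊕ b) with signed a | signed b
    ... | a⁺ , a⁻ | b⁺ , b⁻ = disj-case ⊕-disj a⁺ b⁺ , disj-case ∼⊕-disj a⁻ b⁻
    signed (∼ a) with signed a
    ... | a⁺ , a⁻ = a⁻ , ∼∼-case a⁺

  uniform-induction : ∀ ψ → P ψ
  uniform-induction = proj₁ ∘ signed

-- Semantics

module T = IsLattice ≤t-isLattice
module K = IsLattice ≤k-isLattice

Tr-≤t : ∀ {x y} → x ≤t y → x ∈ Tr → y ∈ Tr
Tr-≤t ≤-refl x∈Tr = x∈Tr
Tr-≤t lo≤ (inj₁ ())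
Tr-≤t lo≤ (inj₂ ())
Tr-≤t ≤hi _ = inj₂ refl

Tr-≤k : ∀ {x y} → x ≤k y → x ∈ Tr → y ∈ Tr
Tr-≤k ≤-refl x∈Tr = x∈Tr
Tr-≤k lo≤ (inj₁ ())
Tr-≤k lo≤ (inj₂ ())
Tr-≤k ≤hi _ = inj₁ refl

Tr-∧ : ∀ x y → (x ∧₄ y) ∈ Tr ⇔ (x ∈ Tr × y ∈ Tr)
Tr-∧ x y = mk⇔ (λ m → Tr-≤t (T.x∧y≤x x y) m , Tr-≤t (T.x∧y≤y x y) m) (uncurry meet)
  where
  meet : ∀ {x y} → x ∈ Tr → y ∈ Tr → (x ∧₄ y) ∈ Tr
  meet (inj₁ refl) (inj₁ refl) = inj₁ refl
  meet (inj₁ refl) (inj₂ refl) = inj₁ refl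
  meet (inj₂ refl) y∈Tr        = y∈Tr

Tr-⊗ : ∀ x y → (x ⊗₄ y) ∈ Tr ⇔ (x ∈ Tr × y ∈ Tr)
Tr-⊗ x y = mk⇔ (λ m → Tr-≤k (K.x∧y≤x x y) m , Tr-≤k (K.x∧y≤y x y) m) (uncurry meet)
  where
  meet : ∀ {x y} → x ∈ Tr → y ∈ Tr → (x ⊗₄ y) ∈ Tr
  meet (inj₁ refl) y∈Tr        = y∈Tr
  meet (inj₂ refl) (inj₁ refl) = inj₂ refl
  meet (inj₂ refl) (inj₂ refl) = inj₂ refl

-- Primeness is the direction that needs cases. The critical join is that of `⊥₄` and `⊤₄`, which is
-- `t₄`; one argument, `⊤₄`, is already in `Tr`.
Tr-∨ : ∀ x y → (x ∨₄ y) ∈ Tr ⇔ (x ∈ Tr ⊎ y ∈ Tr)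
Tr-∨ x y = mk⇔ (prime x y) [ Tr-≤t (T.x≤x∨y x y) , Tr-≤t (T.y≤x∨y x y) ]′
  where
  prime : ∀ x y → (x ∨₄ y) ∈ Tr → x ∈ Tr ⊎ y ∈ Tr
  prime f₄ y  m = inj₂ m
  prime t₄ y  m = inj₁ m
  prime ⊤₄ y  m = inj₁ (inj₁ refl)
  prime ⊥₄ f₄ m = inj₁ m
  prime ⊥₄ ⊥₄ m = inj₁ m
  prime ⊥₄ ⊤₄ m = inj₂ (inj₁ refl)
  prime ⊥₄ t₄ m = inj₂ m

Tr-⊕ : ∀ x y → (x ⊕₄ y) ∈ Tr ⇔ (x ∈ Tr ⊎ y ∈ Tr)
Tr-⊕ x y = mk⇔ (prime x y) [ Tr-≤k (K.x≤x∨y x y) , Tr-≤k (K.y≤x∨y x y) ]′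
  where
  prime : ∀ x y → (x ⊕₄ y) ∈ Tr → x ∈ Tr ⊎ y ∈ Tr
  prime ⊥₄ y  m = inj₂ m
  prime ⊤₄ y  m = inj₁ m
  prime t₄ y  m = inj₁ (inj₂ refl)
  prime f₄ f₄ m = inj₁ m
  prime f₄ ⊥₄ m = inj₁ m
  prime f₄ ⊤₄ m = inj₂ m
  prime f₄ t₄ m = inj₂ (inj₂ refl)

∼₄-∧ : ∀ x y → ∼₄ (x ∧₄ y) ≡ (∼₄ x) ∨₄ (∼₄ y)
∼₄-∧ f₄ y  = refl
∼₄-∧ t₄ y  = refl
∼₄-∧ ⊥₄ f₄ = refl
∼₄-∧ ⊥₄ ⊥₄ = refl
∼₄-∧ ⊥₄ ⊤₄ = refl
∼₄-∧ ⊥₄ t₄ = refl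
∼₄-∧ ⊤₄ f₄ = refl
∼₄-∧ ⊤₄ ⊥₄ = refl
∼₄-∧ ⊤₄ ⊤₄ = refl
∼₄-∧ ⊤₄ t₄ = refl

∼₄-∨ : ∀ x y → ∼₄ (x ∨₄ y) ≡ (∼₄ x) ∧₄ (∼₄ y)
∼₄-∨ f₄ y  = refl
∼₄-∨ t₄ y  = refl
∼₄-∨ ⊥₄ f₄ = refl
∼₄-∨ ⊥₄ ⊥₄ = refl
∼₄-∨ ⊥₄ ⊤₄ = refl
∼₄-∨ ⊥₄ t₄ = refl
∼₄-∨ ⊤₄ f₄ = refl
∼₄-∨ ⊤₄ ⊥₄ = refl
∼₄-∨ ⊤₄ ⊤₄ = refl
∼₄-∨ ⊤₄ t₄ = refl

-- Negation reverses `_≤t_` but preserves `_≤k_`, so it commutes with the operations of the latter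
-- instead of dualising them.
∼₄-⊗ : ∀ x y → ∼₄ (x ⊗₄ y) ≡ (∼₄ x) ⊗₄ (∼₄ y)
∼₄-⊗ ⊥₄ y  = refl
∼₄-⊗ ⊤₄ y  = refl
∼₄-⊗ f₄ f₄ = refl
∼₄-⊗ f₄ ⊥₄ = refl
∼₄-⊗ f₄ ⊤₄ = refl
∼₄-⊗ f₄ t₄ = refl
∼₄-⊗ t₄ f₄ = refl
∼₄-⊗ t₄ ⊥₄ = refl
∼₄-⊗ t₄ ⊤₄ = refl
∼₄-⊗ t₄ t₄ = refl

∼₄-⊕ : ∀ x y → ∼₄ (x ⊕₄ y) ≡ (∼₄ x) ⊕₄ (∼₄ y)
∼₄-⊕ ⊥₄ y  = refl
∼₄-⊕ ⊤₄ y  = refl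
∼₄-⊕ f₄ f₄ = refl
∼₄-⊕ f₄ ⊥₄ = refl
∼₄-⊕ f₄ ⊤₄ = refl
∼₄-⊕ f₄ t₄ = refl
∼₄-⊕ t₄ f₄ = refl
∼₄-⊕ t₄ ⊥₄ = refl
∼₄-⊕ t₄ ⊤₄ = refl
∼₄-⊕ t₄ t₄ = refl

∼₄-involutive : ∀ x → ∼₄ ∼₄ x ≡ x
∼₄-involutive f₄ = refl
∼₄-involutive ⊥₄ = refl
∼₄-involutive ⊤₄ = refl
∼₄-involutive t₄ = refl

-- Truth under a homomorphism, and soundness

module Truth {h : Fm → Four} (hom : IsHomomorphism 𝐅𝐦 𝓕𝓞𝓤𝓡 h) where
  open IsHomomorphism hom

  True : Pred Fm _
  True ψ = h ψ ∈ Tr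

  private
    infixr 5 _≡⇒⇔_
    _≡⇒⇔_ : ∀ {x y} {A : Set} → x ≡ y → y ∈ Tr ⇔ A → x ∈ Tr ⇔ A
    refl ≡⇒⇔ e = e

    neg : ∀ {a x y} → h a ≡ x → ∼₄ x ≡ y → h (∼ a) ≡ y
    neg {a} p q = trans (neg-homo a) (trans (cong ∼₄_ p) q)

    ∼₂ : ∀ (_∙_ : Four → Four → Four) a b → (∼₄ h a) ∙ (∼₄ h b) ≡ h (∼ a) ∙ h (∼ b)
    ∼₂ _∙_ a b rewrite neg-homo a | neg-homo b = refl

  True-conj : Conjunctive c a b → True c ⇔ (True a × True b)
  True-conj (∧-conj {a} {b})  = and-homo a b ≡⇒⇔ Tr-∧ _ _
  True-conj (⊗-conj {a} {b})  = otimes-homo a b ≡⇒⇔ Tr-⊗ _ _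
  True-conj (∼∨-conj {a} {b}) =
    neg (or-homo a b) (∼₄-∨ (h a) (h b)) ≡⇒⇔ ∼₂ _∧₄_ a b ≡⇒⇔ Tr-∧ _ _
  True-conj (∼⊗-conj {a} {b}) =
    neg (otimes-homo a b) (∼₄-⊗ (h a) (h b)) ≡⇒⇔ ∼₂ _⊗₄_ a b ≡⇒⇔ Tr-⊗ _ _

  True-disj : Disjunctive c a b → True c ⇔ (True a ⊎ True b)
  True-disj (∨-disj {a} {b})  = or-homo a b ≡⇒⇔ Tr-∨ _ _
  True-disj (⊕-disj {a} {b})  = oplus-homo a b ≡⇒⇔ Tr-⊕ _ _
  True-disj (∼∧-disj {a} {b}) =
    neg (and-homo a b) (∼₄-∧ (h a) (h b)) ≡⇒⇔ ∼₂ _∨₄_ a b ≡⇒⇔ Tr-∨ _ _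
  True-disj (∼⊕-disj {a} {b}) =
    neg (oplus-homo a b) (∼₄-⊕ (h a) (h b)) ≡⇒⇔ ∼₂ _⊕₄_ a b ≡⇒⇔ Tr-⊕ _ _

  h-∼∼ : ∀ a → h (∼ ∼ a) ≡ h a
  h-∼∼ a = neg (neg-homo a) (∼₄-involutive _)

  private
    ∨⇔ : True (a ∨ b) ⇔ (True a ⊎ True b)
    ∨⇔ = True-disj ∨-disj

    ∧⇔ : True (a ∧ b) ⇔ (True a × True b)
    ∧⇔ = True-conj ∧-conj

    under-∨ : (True a → True b) → True (a ∨ s) → True (b ∨ s)
    under-∨ f = from ∨⇔ ∘ ⊎-map₁ f ∘ to ∨⇔

    -- Each of R12-R23 exchanges, beside a disjunct, two conjunctive or two disjunctive formulas
    -- with the same components.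
    conj-swap : Conjunctive c a b → Conjunctive d a b → True (c ∨ s) → True (d ∨ s)
    conj-swap C D = under-∨ (from (True-conj D) ∘ to (True-conj C))

    disj-swap : Disjunctive c a b → Disjunctive d a b → True (c ∨ s) → True (d ∨ s)
    disj-swap C D = under-∨ (from (True-disj D) ∘ to (True-disj C))

  rule-sound : ∀ {Π φ} → Rule Π φ → ∀ σ → All (λ π → True (π ⟨ σ ⟩)) Π → True (φ ⟨ σ ⟩)
  rule-sound R1  σ (m ∷ [])     = proj₁ (to ∧⇔ m)
  rule-sound R2  σ (m ∷ [])     = proj₂ (to ∧⇔ m)
  rule-sound R3  σ (m ∷ n ∷ []) = from ∧⇔ (m , n)
  rule-sound R4  σ (m ∷ [])     = from ∨⇔ (inj₁ m)
  rule-sound R5  σ (m ∷ [])     = from ∨⇔ (⊎-swap (to ∨⇔ m))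
  rule-sound R6  σ (m ∷ [])     = reduce (to ∨⇔ m)
  rule-sound R7  σ (m ∷ [])     with to ∨⇔ m
  ... | inj₁ x = from ∨⇔ (inj₁ (from ∨⇔ (inj₁ x)))
  ... | inj₂ y = under-∨ (from ∨⇔ ∘ inj₂) y
  rule-sound R8  σ (m ∷ [])     with to ∨⇔ m
  ... | inj₁ x = from ∧⇔ (from ∨⇔ (inj₁ x) , from ∨⇔ (inj₁ x))
  ... | inj₂ y = from ∧⇔ (from ∨⇔ (inj₂ (proj₁ (to ∧⇔ y))) , from ∨⇔ (inj₂ (proj₂ (to ∧⇔ y))))
  rule-sound R9  σ (m ∷ [])     with to ∨⇔ (proj₁ (to ∧⇔ m)) | to ∨⇔ (proj₂ (to ∧⇔ m))
  ... | inj₁ x | _      = from ∨⇔ (inj₁ x)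
  ... | inj₂ _ | inj₁ x = from ∨⇔ (inj₁ x)
  ... | inj₂ y | inj₂ z = from ∨⇔ (inj₂ (from ∧⇔ (y , z)))
  rule-sound R10 σ (m ∷ [])     = under-∨ (subst Tr (sym (h-∼∼ (σ 0)))) m
  rule-sound R11 σ (m ∷ [])     = under-∨ (subst Tr (h-∼∼ (σ 0))) m
  rule-sound R12 σ (m ∷ [])     = conj-swap ∼∨-conj ∧-conj m
  rule-sound R13 σ (m ∷ [])     = conj-swap ∧-conj ∼∨-conj m
  rule-sound R14 σ (m ∷ [])     = disj-swap ∼∧-disj ∨-disj m
  rule-sound R15 σ (m ∷ [])     = disj-swap ∨-disj ∼∧-disj m
  rule-sound R16 σ (m ∷ [])     = conj-swap ⊗-conj ∧-conj m
  rule-sound R17 σ (m ∷ [])     = conj-swap ∧-conj ⊗-conj m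
  rule-sound R18 σ (m ∷ [])     = disj-swap ⊕-disj ∨-disj m
  rule-sound R19 σ (m ∷ [])     = disj-swap ∨-disj ⊕-disj m
  rule-sound R20 σ (m ∷ [])     = conj-swap ⊗-conj ∼⊗-conj m
  rule-sound R21 σ (m ∷ [])     = conj-swap ∼⊗-conj ⊗-conj m
  rule-sound R22 σ (m ∷ [])     = disj-swap ⊕-disj ∼⊕-disj m
  rule-sound R23 σ (m ∷ [])     = disj-swap ∼⊕-disj ⊕-disj m

  mutual
    ⊢-sound : Γ ⊆ True → Γ ⊢H φ → True φ
    ⊢-sound Γ-true (hyp γ∈Γ)     = Γ-true γ∈Γ
    ⊢-sound Γ-true (rule R σ ds) = rule-sound R σ (⊢-sound* Γ-true ds)

    ⊢-sound* : ∀ {σ Π} → Γ ⊆ True → All (λ π → Γ ⊢H π ⟨ σ ⟩) Π → All (λ π → True (π ⟨ σ ⟩)) Π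
    ⊢-sound* Γ-true []       = []
    ⊢-sound* Γ-true (d ∷ ds) = ⊢-sound Γ-true d ∷ ⊢-sound* Γ-true ds

soundness : Γ ⊢H φ → Γ ⊨LB φ
soundness d h hom Γ-true = Truth.⊢-sound hom Γ-true d

-- Derived rules

-- The rules are stated in the variables numbered 0, 1 and 2; `c` doubles as the default beyond
-- them.
inst : Fm → Fm → Fm → ℕ → Fm
inst a b c 0             = a
inst a b c 1             = b
inst a b c (suc (suc _)) = c

∧-elimˡ : Γ ⊢H a ∧ b → Γ ⊢H a
∧-elimˡ {a = a} {b} d = rule R1 (inst a b b) (d ∷ [])

∧-elimʳ : Γ ⊢H a ∧ b → Γ ⊢H b
∧-elimʳ {a = a} {b} d = rule R2 (inst a b b) (d ∷ [])

∧-intro : Γ ⊢H a → Γ ⊢H b → Γ ⊢H a ∧ b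
∧-intro {a = a} {b} d e = rule R3 (inst a b b) (d ∷ e ∷ [])

∨-introˡ : Γ ⊢H a → Γ ⊢H a ∨ b
∨-introˡ {a = a} {b} d = rule R4 (inst a b b) (d ∷ [])

∨-comm : Γ ⊢H a ∨ b → Γ ⊢H b ∨ a
∨-comm {a = a} {b} d = rule R5 (inst a b b) (d ∷ [])

∨-introʳ : Γ ⊢H b → Γ ⊢H a ∨ b
∨-introʳ = ∨-comm ∘ ∨-introˡ

∨-idem : Γ ⊢H a ∨ a → Γ ⊢H a
∨-idem {a = a} d = rule R6 (inst a a a) (d ∷ [])

∨-assocˡ : Γ ⊢H a ∨ (b ∨ c) → Γ ⊢H (a ∨ b) ∨ c
∨-assocˡ {a = a} {b} {c} d = rule R7 (inst a b c) (d ∷ [])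

-- R7 reassociates in one direction only; two uses of it, with commutations at the root around them,
-- go the other way.
∨-assocʳ : Γ ⊢H (a ∨ b) ∨ c → Γ ⊢H a ∨ (b ∨ c)
∨-assocʳ = ∨-comm ∘ ∨-assocˡ ∘ ∨-comm ∘ ∨-assocˡ ∘ ∨-comm

-- The middle disjunct comes to the front and the outer two merge into one side formula, which lets
-- distributivity act on `b`.
∨-rotate : Γ ⊢H (a ∨ b) ∨ c → Γ ⊢H b ∨ (c ∨ a)
∨-rotate = ∨-assocʳ ∘ ∨-comm ∘ ∨-assocʳ

∨-rotate⁻¹ : Γ ⊢H b ∨ (c ∨ a) → Γ ⊢H (a ∨ b) ∨ c
∨-rotate⁻¹ = ∨-assocˡ ∘ ∨-comm ∘ ∨-assocˡ

∧∨-intro : Γ ⊢H a ∨ s → Γ ⊢H b ∨ s → Γ ⊢H (a ∧ b) ∨ s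
∧∨-intro {a = a} {s} {b} d e =
  ∨-comm (rule R9 (inst s a b) (∧-intro (∨-comm d) (∨-comm e) ∷ []))

∧∨-elim : Γ ⊢H (a ∧ b) ∨ s → Γ ⊢H (s ∨ a) ∧ (s ∨ b)
∧∨-elim {a = a} {b} {s} d = rule R8 (inst s a b) (∨-comm d ∷ [])

∧∨-elimˡ : Γ ⊢H (a ∧ b) ∨ s → Γ ⊢H a ∨ s
∧∨-elimˡ = ∨-comm ∘ ∧-elimˡ ∘ ∧∨-elim

∧∨-elimʳ : Γ ⊢H (a ∧ b) ∨ s → Γ ⊢H b ∨ s
∧∨-elimʳ = ∨-comm ∘ ∧-elimʳ ∘ ∧∨-elim

insertˡ : Γ ⊢H b ∨ s → Γ ⊢H (a ∨ b) ∨ s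
insertˡ = ∨-assocˡ ∘ ∨-introʳ

insertʳ : Γ ⊢H a ∨ s → Γ ⊢H (a ∨ b) ∨ s
insertʳ = ∨-comm ∘ ∨-assocʳ ∘ ∨-introˡ ∘ ∨-comm

-- R5 and R7 only move the root of a disjunction, viewed as an unrooted plane
-- tree.  For the next three lemmas they suffice together with R4 and R6, because
-- the tree of the premise (for ∨-assocˡ-∨, up to ∨-comm-∨) is obtained by
-- deleting leaves from that of t ∨ t, where t is the conclusion.
∨-comm-∨ : Γ ⊢H (a ∨ b) ∨ s → Γ ⊢H (b ∨ a) ∨ s
∨-comm-∨ = ∨-idem ∘ ∨-assocˡ ∘ insertʳ ∘ ∨-assocʳ ∘ ∨-comm ∘ insertʳ ∘ insertˡ ∘ ∨-assocʳ

∨-idem-∨ : Γ ⊢H (a ∨ a) ∨ s → Γ ⊢H a ∨ s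
∨-idem-∨ = ∨-idem ∘ insertʳ ∘ ∨-assocʳ

∨-assocˡ-∨ : Γ ⊢H (a ∨ (b ∨ c)) ∨ s → Γ ⊢H ((a ∨ b) ∨ c) ∨ s
∨-assocˡ-∨ =
  ∨-idem ∘ insertʳ ∘ ∨-assocˡ ∘ insertˡ ∘ ∨-assocʳ ∘ ∨-comm ∘
  ∨-assocˡ ∘ insertʳ ∘ insertʳ ∘ ∨-assocʳ ∘
  ∨-comm-∨ ∘ ∨-comm ∘ ∨-rotate

-- Replacement beside a disjunct, and the rules with an added disjunct

module _ {Γ : Pred Fm ℓ} where

  -- The shape of R10–R23: a is replaced by b in the presence of a side formula.
  Replaceable : Fm → Fm → Set ℓ
  Replaceable a b = ∀ {s} → Γ ⊢H a ∨ s → Γ ⊢H b ∨ s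

  -- The side formula is arbitrary, so a further disjunct is absorbed by taking `c ∨ s` for it.
  replace-∨ : Replaceable a b → Replaceable (a ∨ c) (b ∨ c)
  replace-∨ f = ∨-assocˡ ∘ f ∘ ∨-assocʳ

  -- The side formula is chosen to be `b` itself, and R6 contracts `b ∨ b`.
  replace : Replaceable a b → Γ ⊢H a → Γ ⊢H b
  replace f = ∨-idem ∘ f ∘ ∨-introˡ

  ∼∼-intro : Replaceable a (∼ ∼ a)
  ∼∼-intro {a} {s} d = rule R10 (inst a a s) (d ∷ [])

  ∼∼-elim : Replaceable (∼ ∼ a) a
  ∼∼-elim {a} {s} d = rule R11 (inst a a s) (d ∷ [])

  conj-elim : Conjunctive c a b → Replaceable c (a ∧ b)
  conj-elim ∧-conj            d = d
  conj-elim (⊗-conj {a} {b})  d = rule R16 (inst a b _) (d ∷ [])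
  conj-elim (∼∨-conj {a} {b}) d = rule R12 (inst a b _) (d ∷ [])
  conj-elim (∼⊗-conj {a} {b}) d = conj-elim ⊗-conj (rule R21 (inst a b _) (d ∷ []))

  conj-intro : Conjunctive c a b → Replaceable (a ∧ b) c
  conj-intro ∧-conj            d = d
  conj-intro (⊗-conj {a} {b})  d = rule R17 (inst a b _) (d ∷ [])
  conj-intro (∼∨-conj {a} {b}) d = rule R13 (inst a b _) (d ∷ [])
  conj-intro (∼⊗-conj {a} {b}) d = rule R20 (inst a b _) (conj-intro ⊗-conj d ∷ [])

  disj-elim : Disjunctive c a b → Replaceable c (a ∨ b)
  disj-elim ∨-disj            d = d
  disj-elim (⊕-disj {a} {b})  d = rule R18 (inst a b _) (d ∷ [])
  disj-elim (∼∧-disj {a} {b}) d = rule R14 (inst a b _) (d ∷ [])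
  disj-elim (∼⊕-disj {a} {b}) d = disj-elim ⊕-disj (rule R23 (inst a b _) (d ∷ []))

  disj-intro : Disjunctive c a b → Replaceable (a ∨ b) c
  disj-intro ∨-disj            d = d
  disj-intro (⊕-disj {a} {b})  d = rule R19 (inst a b _) (d ∷ [])
  disj-intro (∼∧-disj {a} {b}) d = rule R15 (inst a b _) (d ∷ [])
  disj-intro (∼⊕-disj {a} {b}) d = rule R22 (inst a b _) (disj-intro ⊕-disj d ∷ [])

  private
    conj-swap : Conjunctive c a b → Conjunctive d a b → Replaceable (c ∨ s) (d ∨ s)
    conj-swap C D = replace-∨ (conj-intro D ∘ conj-elim C)

    disj-swap : Disjunctive c a b → Disjunctive d a b → Replaceable (c ∨ s) (d ∨ s)
    disj-swap C D = replace-∨ (disj-intro D ∘ disj-elim C)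

  rule-∨ : ∀ {Π φ} → Rule Π φ → ∀ σ →
           All (λ π → Γ ⊢H π ⟨ σ ⟩ ∨ s) Π → Γ ⊢H φ ⟨ σ ⟩ ∨ s
  rule-∨ R1  σ (d ∷ [])     = ∧∨-elimˡ d
  rule-∨ R2  σ (d ∷ [])     = ∧∨-elimʳ d
  rule-∨ R3  σ (d ∷ e ∷ []) = ∧∨-intro d e
  rule-∨ R4  σ (d ∷ [])     = insertʳ d
  rule-∨ R5  σ (d ∷ [])     = ∨-comm-∨ d
  rule-∨ R6  σ (d ∷ [])     = ∨-idem-∨ d
  rule-∨ R7  σ (d ∷ [])     = ∨-assocˡ-∨ d
  rule-∨ R8  σ (d ∷ [])     = ∧∨-intro (∨-rotate⁻¹ (∧∨-elimˡ (∨-rotate d)))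
                                       (∨-rotate⁻¹ (∧∨-elimʳ (∨-rotate d)))
  rule-∨ R9  σ (d ∷ [])     = ∨-rotate⁻¹ (∧∨-intro (∨-rotate (∧∨-elimˡ d))
                                                   (∨-rotate (∧∨-elimʳ d)))
  rule-∨ R10 σ (d ∷ [])     = replace-∨ ∼∼-intro d
  rule-∨ R11 σ (d ∷ [])     = replace-∨ ∼∼-elim d
  rule-∨ R12 σ (d ∷ [])     = conj-swap ∼∨-conj ∧-conj d
  rule-∨ R13 σ (d ∷ [])     = conj-swap ∧-conj ∼∨-conj d
  rule-∨ R14 σ (d ∷ [])     = disj-swap ∼∧-disj ∨-disj d
  rule-∨ R15 σ (d ∷ [])     = disj-swap ∨-disj ∼∧-disj d
  rule-∨ R16 σ (d ∷ [])     = conj-swap ⊗-conj ∧-conj d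
  rule-∨ R17 σ (d ∷ [])     = conj-swap ∧-conj ⊗-conj d
  rule-∨ R18 σ (d ∷ [])     = disj-swap ⊕-disj ∨-disj d
  rule-∨ R19 σ (d ∷ [])     = disj-swap ∨-disj ⊕-disj d
  rule-∨ R20 σ (d ∷ [])     = conj-swap ⊗-conj ∼⊗-conj d
  rule-∨ R21 σ (d ∷ [])     = conj-swap ∼⊗-conj ⊗-conj d
  rule-∨ R22 σ (d ∷ [])     = disj-swap ⊕-disj ∼⊕-disj d
  rule-∨ R23 σ (d ∷ [])     = disj-swap ∼⊕-disj ⊕-disj d

-- Cut and proof by cases

module _ {Γ : Pred Fm ℓ} {Δ : Pred Fm ℓ′} where
  mutual
    cut : Γ ⊆ (Δ ⊢H_) → Γ ⊢H φ → Δ ⊢H φ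
    cut f (hyp γ∈Γ)     = f γ∈Γ
    cut f (rule R σ ds) = rule R σ (cut* f ds)

    cut* : ∀ {σ Π} → Γ ⊆ (Δ ⊢H_) →
           All (λ π → Γ ⊢H π ⟨ σ ⟩) Π → All (λ π → Δ ⊢H π ⟨ σ ⟩) Π
    cut* f []       = []
    cut* f (d ∷ ds) = cut f d ∷ cut* f ds

  mutual
    -- The derivation is replayed with `s` attached to every line, `rule-∨` standing in for each
    -- rule.
    cut-∨ : (∀ {γ} → γ ∈ Γ → Δ ⊢H γ ∨ s) → Γ ⊢H φ → Δ ⊢H φ ∨ s
    cut-∨ f (hyp γ∈Γ)     = f γ∈Γ
    cut-∨ f (rule R σ ds) = rule-∨ R σ (cut-∨* f ds)

    cut-∨* : ∀ {σ Π} → (∀ {γ} → γ ∈ Γ → Δ ⊢H γ ∨ s) →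
             All (λ π → Γ ⊢H π ⟨ σ ⟩) Π → All (λ π → Δ ⊢H π ⟨ σ ⟩ ∨ s) Π
    cut-∨* f []       = []
    cut-∨* f (d ∷ ds) = cut-∨ f d ∷ cut-∨* f ds

weaken : Γ ⊆ Δ → Γ ⊢H φ → Δ ⊢H φ
weaken Γ⊆Δ = cut (hyp ∘ Γ⊆Δ)

infixl 4 _,,_

_,,_ : Pred Fm ℓ → Fm → Pred Fm ℓ
Γ ,, ψ = ｛ ψ ｝ ∪ Γ

cut-hyp : Γ ⊢H ψ → Γ ,, ψ ⊢H φ → Γ ⊢H φ
cut-hyp d = cut λ { (inj₁ refl) → d ; (inj₂ γ∈Γ) → hyp γ∈Γ }

replace-hyp : Γ ,, χ ⊢H ψ → Γ ,, ψ ⊢H φ → Γ ,, χ ⊢H φ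
replace-hyp d = cut λ { (inj₁ refl) → d ; (inj₂ γ∈Γ) → hyp (inj₂ γ∈Γ) }

∨-hyp : Γ ,, a ⊢H φ → Γ ⊢H a ∨ s → Γ ⊢H φ ∨ s
∨-hyp d e = cut-∨ (λ { (inj₁ refl) → e ; (inj₂ γ∈Γ) → ∨-introˡ (hyp γ∈Γ) }) d

-- The disjuncts are replaced one after the other: `a ∨ b` becomes `φ ∨ b`, then `φ ∨ φ`, which R6
-- contracts.
∨-elim : Γ ,, a ⊢H φ → Γ ,, b ⊢H φ → Γ ⊢H a ∨ b → Γ ⊢H φ
∨-elim d e = ∨-idem ∘ ∨-hyp e ∘ ∨-comm ∘ ∨-hyp d

-- The saturated theory

module Saturation (em : ExcludedMiddle ℓ) (Γ : Pred Fm ℓ) (φ : Fm) (Γ⊬φ : ¬ (Γ ⊢H φ)) where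

  -- The test on `ψ` sits inside the membership condition, so the set is defined without deciding
  -- it; only `extend-⊬` does.
  extend : Fm → Pred Fm ℓ → Pred Fm ℓ
  extend ψ Δ χ = χ ∈ Δ ⊎ (χ ≡ ψ × ¬ (Δ ,, ψ ⊢H φ))

  -- According to the outcome of the test, the extended set is contained in `Δ` or in `Δ ,, ψ`,
  -- neither of which derives `φ`.
  extend-⊬ : ∀ ψ → ¬ (Δ ⊢H φ) → ¬ (extend ψ Δ ⊢H φ)
  extend-⊬ {Δ} ψ Δ⊬φ d with em {Δ ,, ψ ⊢H φ}
  ... | yes e = Δ⊬φ (weaken (λ { (inj₁ x) → x ; (inj₂ (_ , ⊬)) → contradiction e ⊬ }) d)
  ... | no ⊬  = ⊬ (weaken (λ { (inj₁ x) → inj₂ x ; (inj₂ (refl , _)) → inj₁ refl }) d)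

  stage : ℕ → Pred Fm ℓ
  stage zero    = Γ
  stage (suc n) = extend (∼ var n) (extend (var n) (stage n))

  stage-⊬ : ∀ n → ¬ (stage n ⊢H φ)
  stage-⊬ zero    = Γ⊬φ
  stage-⊬ (suc n) = extend-⊬ (∼ var n) (extend-⊬ (var n) (stage-⊬ n))

  stage-mono : ∀ {m n} → m ≤ n → stage m ⊆ stage n
  stage-mono = go ∘ ≤⇒≤′
    where
    go : ∀ {m n} → m ≤′ n → stage m ⊆ stage n
    go (≤′-reflexive refl) x = x
    go (≤′-step m≤n)       x = inj₁ (inj₁ (go m≤n x))

  limit : Pred Fm ℓ
  limit χ = ∃ λ n → χ ∈ stage n

  mutual
    -- A derivation uses finitely many hypotheses and the stages increase, so the maximum of the
    -- stages involved suffices.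
    compact : limit ⊢H ψ → ∃ λ n → stage n ⊢H ψ
    compact (hyp (n , x))   = n , hyp x
    compact (rule R σ ds)   = let n , es = compact* ds in n , rule R σ es

    compact* : ∀ {σ Π} → All (λ π → limit ⊢H π ⟨ σ ⟩) Π →
               ∃ λ n → All (λ π → stage n ⊢H π ⟨ σ ⟩) Π
    compact* []       = zero , []
    compact* (d ∷ ds) =
      let m , e  = compact d
          n , es = compact* ds
      in m ⊔ n , weaken (stage-mono (m≤m⊔n m n)) e
               ∷ cut* (hyp ∘ stage-mono (m≤n⊔m m n)) es

  limit-⊬ : ¬ (limit ⊢H φ)
  limit-⊬ d = let n , e = compact d in stage-⊬ n e

  Consistent : Pred Fm ℓ
  Consistent ψ = ¬ (limit ,, ψ ⊢H φ)

  private
    via : ∀ {χ ψ} → limit ,, χ ⊢H ψ → Consistent χ → Consistent ψ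
    via d χ-con e = χ-con (replace-hyp d e)

    ⊢χ : ∀ {χ} → limit ,, χ ⊢H χ
    ⊢χ = hyp (inj₁ refl)

    stage-con : ∀ {χ} → Δ ⊆ limit → Consistent χ → ¬ (Δ ,, χ ⊢H φ)
    stage-con Δ⊆ con = con ∘ weaken λ { (inj₁ x) → inj₁ x ; (inj₂ x) → inj₂ (Δ⊆ x) }

  -- Consistency with the limit gives consistency with the smaller set against which the literal was
  -- tested, so the literal was added.
  var-saturated : ∀ n → Consistent (var n) → limit ⊢H var n
  var-saturated n con = hyp (suc n , inj₁ (inj₂ (refl , stage-con (n ,_) con)))

  ∼var-saturated : ∀ n → Consistent (∼ var n) → limit ⊢H ∼ var n
  -- `∼ var n` was tested after `var n`, against a set between stages `n` and `suc n`; its inclusion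
  -- in the limit goes through the latter.
  ∼var-saturated n con = hyp (suc n , inj₂ (refl , stage-con (λ x → suc n , inj₁ x) con))

  conj-consistent : Conjunctive c a b → Consistent c → Consistent a × Consistent b
  conj-consistent C con = via (∧-elimˡ a∧b) con , via (∧-elimʳ a∧b) con
    where a∧b = replace (conj-elim C) ⊢χ

  -- If `φ` followed on adding either component, proof by cases would derive it on adding `c`.
  disj-consistent : Disjunctive c a b → Consistent c → Consistent a ⊎ Consistent b
  disj-consistent {a = a} {b} D con with em {limit ,, a ⊢H φ}
  ... | no a-con = inj₁ a-con
  ... | yes d    = inj₂ λ e → via (replace (disj-elim D) ⊢χ) con
    (∨-elim (weaken left d) (weaken left e) ⊢χ)
    where
    left : ∀ {χ ψ} → (limit ,, χ) ⊆ (limit ,, ψ ,, χ)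
    left (inj₁ x) = inj₁ x
    left (inj₂ x) = inj₂ (inj₂ x)

  ∼∼-consistent : Consistent (∼ ∼ a) → Consistent a
  ∼∼-consistent = via (replace ∼∼-elim ⊢χ)

  -- Belnap's reading of the values: `A` is evidence for a variable, `B` evidence against it.
  four : ∀ {A B : Set ℓ} → Dec A → Dec B → Four
  four (yes _) (yes _) = ⊤₄
  four (yes _) (no _)  = t₄
  four (no _)  (yes _) = f₄
  four (no _)  (no _)  = ⊥₄

  Tr-four : ∀ {A B} (A? : Dec A) (B? : Dec B) → four A? B? ∈ Tr ⇔ A
  Tr-four (yes x) (yes _) = mk⇔ (λ _ → x) (λ _ → inj₁ refl)
  Tr-four (yes x) (no _)  = mk⇔ (λ _ → x) (λ _ → inj₂ refl)
  Tr-four (no ¬x) (yes _) = mk⇔ (λ { (inj₁ ()) ; (inj₂ ()) }) (λ x → contradiction x ¬x)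
  Tr-four (no ¬x) (no _)  = mk⇔ (λ { (inj₁ ()) ; (inj₂ ()) }) (λ x → contradiction x ¬x)

  -- Negation exchanges `t₄` and `f₄` and fixes the other values, which amounts to swapping `A` and
  -- `B`.
  Tr-∼four : ∀ {A B} (A? : Dec A) (B? : Dec B) → (∼₄ four A? B?) ∈ Tr ⇔ B
  Tr-∼four (yes _) (yes y) = mk⇔ (λ _ → y) (λ _ → inj₁ refl)
  Tr-∼four (no _)  (yes y) = mk⇔ (λ _ → y) (λ _ → inj₂ refl)
  Tr-∼four (yes _) (no ¬y) = mk⇔ (λ { (inj₁ ()) ; (inj₂ ()) }) (λ y → contradiction y ¬y)
  Tr-∼four (no _)  (no ¬y) = mk⇔ (λ { (inj₁ ()) ; (inj₂ ()) }) (λ y → contradiction y ¬y)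

  eval : Fm → Four
  eval (var n) = four (em {limit ⊢H var n}) (em {limit ⊢H ∼ var n})
  eval (a ∧ b) = eval a ∧₄ eval b
  eval (a ∨ b) = eval a ∨₄ eval b
  eval (a ⊗ b) = eval a ⊗₄ eval b
  eval (a ⊕ b) = eval a ⊕₄ eval b
  eval (∼ a)   = ∼₄ eval a

  eval-hom : IsHomomorphism 𝐅𝐦 𝓕𝓞𝓤𝓡 eval
  eval-hom = record
    { and-homo    = λ _ _ → refl
    ; or-homo     = λ _ _ → refl
    ; otimes-homo = λ _ _ → refl
    ; oplus-homo  = λ _ _ → refl
    ; neg-homo    = λ _ → refl
    }

  open Truth eval-hom

  -- Consistency descends to both components of a conjunctive formula and to one of a disjunctive
  -- formula, until saturation makes the literals derivable and so true.
  Consistent⇒True : ∀ ψ → Consistent ψ → True ψ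
  Consistent⇒True = uniform-induction (λ ψ → Consistent ψ → True ψ)
    (λ n con → from (Tr-four em em) (var-saturated n con))
    (λ n con → from (Tr-∼four em em) (∼var-saturated n con))
    (λ { C f g con → let x , y = conj-consistent C con in from (True-conj C) (f x , g y) })
    (λ { D f g con → from (True-disj D) (⊎-map f g (disj-consistent D con)) })
    (λ { {a} f con → subst Tr (sym (h-∼∼ a)) (f (∼∼-consistent con)) })

  -- True literals are derivable by the choice of `eval`, and the introduction rules build up the
  -- other true formulas.
  True⇒⊢ : ∀ ψ → True ψ → limit ⊢H ψ
  True⇒⊢ = uniform-induction (λ ψ → True ψ → limit ⊢H ψ)
    (λ n → to (Tr-four em em))
    (λ n → to (Tr-∼four em em))
    (λ { C f g m → let x , y = to (True-conj C) m in replace (conj-intro C) (∧-intro (f x) (g y)) })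
    (λ { D f g m → replace (disj-intro D) ([ ∨-introˡ ∘ f , ∨-introʳ ∘ g ]′ (to (True-disj D) m)) })
    (λ { {a} f m → replace ∼∼-intro (f (subst Tr (h-∼∼ a) m)) })

  not-entailed : ¬ (Γ ⊨LB φ)
  not-entailed ⊨φ = limit-⊬ (True⇒⊢ φ (⊨φ eval eval-hom Γ-true))
    where
    Γ-true : Γ ⊆ True
    -- A member of `Γ` is in the limit, so adding it again cannot make `φ` derivable.
    Γ-true {γ} γ∈Γ = Consistent⇒True γ λ d → limit-⊬ (cut-hyp (hyp (zero , γ∈Γ)) d)

-- Completeness by contraposition, and the equivalence

completeness : {Γ : Pred Fm ℓ} → ExcludedMiddle ℓ → Γ ⊨LB φ → Γ ⊢H φ
completeness {φ = φ} {Γ = Γ} em ⊨φ with em {Γ ⊢H φ}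
... | yes d = d
... | no ⊬φ = contradiction ⊨φ (Saturation.not-entailed em Γ φ ⊬φ)

theorem3p2p11 : {ℓ : Level} → ExcludedMiddle ℓ →
    (Γ : Pred Fm ℓ) (φ : Fm) → (Γ ⊨LB φ) ⇔ (Γ ⊢H φ)
theorem3p2p11 em Γ φ = mk⇔ (completeness em) soundness
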